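{- A syllogism is valid if and only if it is provable in the formal system SYLL.
   Context: **Categorical propositions.** For term-variables $A,B$ there are four categorical propositions with subject $A$ and predicate $B$: $\mathbf{A}_{AB}$ (Each $A$ is $B$), $\mathbf{E}_{AB}$ (No $A$ is $B$), $\mathbf{I}_{AB}$ (Some $A$ is $B$), $\mathbf{O}_{AB}$ (Some $A$ is not $B$). The propositions $\mathbf{I}$ and $\mathbf{O}$ are particular and $\mathbf{A}$ and $\mathbf{E}$ are universal. **Syllogisms.** Let $S,P,M$ be three distinct term-variables. A syllogism is an expression $P_1,P_2\vdash C$ with $P_1,P_2,C$ categorical propositions, where the first premise $P_1$ involves exactly $M$ and $P$ (in either order, as subject and predicate), the second premise $P_2$ involves exactly $S$ and $M$ (in either order), and the conclusion $C$ has subject $S$ and predicate $P$. Its mood is the sequence of kinds of $P_1,P_2,C$. Its figure is: fig. 1 if the premises have (subject, predicate) $MP,SM$; fig. 2 if $PM,SM$; fig. 3 if $MP,MS$; fig. 4 if $PM,MS$. So there are $4^3\cdot 4=256$ syllogisms. **Valid syllogisms.** The valid syllogisms (without existential import) are exactly the following 15: - Fig. 1: $\mathbf{A}_{MP},\mathbf{A}_{SM}\vdash\mathbf{A}_{SP}$; $\mathbf{E}_{MP},\mathbf{A}_{SM}\vdash\mathbf{E}_{SP}$; $\mathbf{A}_{MP},\mathbf{I}_{SM}\vdash\mathbf{I}_{SP}$; $\mathbf{E}_{MP},\mathbf{I}_{SM}\vdash\mathbf{O}_{SP}$. - Fig. 2: $\mathbf{E}_{PM},\mathbf{A}_{SM}\vdash\mathbf{E}_{SP}$;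 $\mathbf{A}_{PM},\mathbf{E}_{SM}\vdash\mathbf{E}_{SP}$; $\mathbf{E}_{PM},\mathbf{I}_{SM}\vdash\mathbf{O}_{SP}$; $\mathbf{A}_{PM},\mathbf{O}_{SM}\vdash\mathbf{O}_{SP}$. - Fig. 3: $\mathbf{I}_{MP},\mathbf{A}_{MS}\vdash\mathbf{I}_{SP}$; $\mathbf{A}_{MP},\mathbf{I}_{MS}\vdash\mathbf{I}_{SP}$; $\mathbf{O}_{MP},\mathbf{A}_{MS}\vdash\mathbf{O}_{SP}$; $\mathbf{E}_{MP},\mathbf{I}_{MS}\vdash\mathbf{O}_{SP}$. - Fig. 4: $\mathbf{A}_{PM},\mathbf{E}_{MS}\vdash\mathbf{E}_{SP}$; $\mathbf{I}_{PM},\mathbf{A}_{MS}\vdash\mathbf{I}_{SP}$; $\mathbf{E}_{PM},\mathbf{I}_{MS}\vdash\mathbf{O}_{SP}$. **Diagrams of SYLL.** The syntactic primitives are the symbols $\to$, $\leftarrow$, $\bullet$ and countably many term-variables $A,B,C,\dots$. A diagram is a finite list of arrow symbols ($\to$ or $\leftarrow$) separated by a single bullet or term-variable, beginning and ending at a term-variable (a single term-variable is a diagram). A part of a diagram is a finite list of consecutive components of it; parts are denoted $\mathcal{D},\mathcal{E}$. The categorical propositions are represented by the syllogistic diagrams $$\mathbf{A}_{AB}: A\to B,\quad \mathbf{E}_{AB}: A\to\bullet\leftarrow B,\quad \mathbf{I}_{AB}: A\leftarrow\bullet\to B,\quad \mathbf{O}_{AB}: A\leftarrow\bullet\to\bullet\leftarrow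 B.$$ **Rules of inference of SYLL** (for all term-variables $A,B$ and all parts $\mathcal{D},\mathcal{E}$ such that the expressions are diagrams): 1. from $A\to B$ infer $B\leftarrow A$, and conversely; 2. from $A\to\bullet\leftarrow B$ infer $B\to\bullet\leftarrow A$; 3. from $A\leftarrow\bullet\to B$ infer $B\leftarrow\bullet\to A$; 4. from $A\leftarrow\bullet\to\bullet\leftarrow B$ infer $B\to\bullet\leftarrow\bullet\to A$, and conversely; 5. from the two diagrams $\mathcal{D}A$ and $A\mathcal{E}$ (in either order) infer the diagram $\mathcal{D}A\mathcal{E}$ obtained by overlapping them on the common extremal $A$; 6. from $\mathcal{D}\to A\to\mathcal{E}$ infer $\mathcal{D}\to\mathcal{E}$; 7. from $\mathcal{D}\leftarrow A\leftarrow\mathcal{E}$ infer $\mathcal{D}\leftarrow\mathcal{E}$. **Provability.** A proof tree of SYLL is a tree in which each node is a diagram and each branching is an instance of a rule of inference. A formal proof of a syllogism is a proof tree with (the syllogistic diagram of) its conclusion as the root and with (the syllogistic diagrams of) each of its premises as leaves. A syllogism is provable in SYLL if there is a formal proof for it. -}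

module Defs where

open import Data.Nat using (ℕ)
open import Data.List using (List; []; _∷_; _++_; _∷ʳ_; [_])
open import Data.List.Membership.Propositional using (_∈_)
open import Data.List.Relation.Unary.All using (All)
open import Data.Product using (Σ-syntax; _×_)
open import Data.Sum using (_⊎_)
open import Relation.Binary.PropositionalEquality using (_≡_)

TermVar : Set
TermVar = ℕ

------------------------------------------------------------------------
-- Categorical propositions and syllogisms

-- The first argument is the subject, the second the predicate.
data Proposition : Set where
  𝐀 𝐄 𝐈 𝐎 : TermVar → TermVar → Proposition

subject : Proposition → TermVar
subject (𝐀 A B) = A
subject (𝐄 A B) = A
subject (𝐈 A B) = A
subject (𝐎 A B) = A

predicate : Proposition → TermVar
predicate (𝐀 A B) = B
predicate (𝐄 A B) = B
predicate (𝐈 A B) = B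
predicate (𝐎 A B) = B

infix 4 _,_⊢_

record Argument : Set where
  constructor _,_⊢_
  field
    premise₁ premise₂ conclusion : Proposition

open Argument public

Involves : TermVar → TermVar → Proposition → Set
Involves A B p =
  (subject p ≡ A × predicate p ≡ B) ⊎ (subject p ≡ B × predicate p ≡ A)

-- The distinctness of S, P and M is left to the user of this predicate.
record IsSyllogism (S P M : TermVar) (σ : Argument) : Set where
  field
    premise₁-terms       : Involves M P (premise₁ σ)
    premise₂-terms       : Involves S M (premise₂ σ)
    conclusion-subject   : subject (conclusion σ) ≡ S
    conclusion-predicate : predicate (conclusion σ) ≡ P

-- Validity without existential import, given by the traditional list;
-- the four groups are the four figures.
data Valid (S P M : TermVar) : Argument → Set where
  barbara   : Valid S P M (𝐀 M P , 𝐀 S M ⊢ 𝐀 S P)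
  celarent  : Valid S P M (𝐄 M P , 𝐀 S M ⊢ 𝐄 S P)
  darii     : Valid S P M (𝐀 M P , 𝐈 S M ⊢ 𝐈 S P)
  ferio     : Valid S P M (𝐄 M P , 𝐈 S M ⊢ 𝐎 S P)

  cesare    : Valid S P M (𝐄 P M , 𝐀 S M ⊢ 𝐄 S P)
  camestres : Valid S P M (𝐀 P M , 𝐄 S M ⊢ 𝐄 S P)
  festino   : Valid S P M (𝐄 P M , 𝐈 S M ⊢ 𝐎 S P)
  baroco    : Valid S P M (𝐀 P M , 𝐎 S M ⊢ 𝐎 S P)

  disamis   : Valid S P M (𝐈 M P , 𝐀 M S ⊢ 𝐈 S P)
  datisi    : Valid S P M (𝐀 M P , 𝐈 M S ⊢ 𝐈 S P)
  bocardo   : Valid S P M (𝐎 M P , 𝐀 M S ⊢ 𝐎 S P)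
  ferison   : Valid S P M (𝐄 M P , 𝐈 M S ⊢ 𝐎 S P)

  calemes   : Valid S P M (𝐀 P M , 𝐄 M S ⊢ 𝐄 S P)
  dimatis   : Valid S P M (𝐈 P M , 𝐀 M S ⊢ 𝐈 S P)
  fresison  : Valid S P M (𝐄 P M , 𝐈 M S ⊢ 𝐎 S P)

------------------------------------------------------------------------
-- Diagrams

data Symbol : Set where
  ⟶ ⟵ ● : Symbol
  var   : TermVar → Symbol

data IsArrow : Symbol → Set where
  right : IsArrow ⟶
  left  : IsArrow ⟵

data IsSeparator : Symbol → Set where
  bullet : IsSeparator ●
  term   : ∀ {A} → IsSeparator (var A)

-- The lists that can follow a bullet or a term-variable, other than the
-- final term-variable, in a diagram.
data IsTail : List Symbol → Set where
  end  : ∀ {a A} → IsArrow a → IsTail (a ∷ var A ∷ [])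
  step : ∀ {a s xs} → IsArrow a → IsSeparator s → IsTail xs →
         IsTail (a ∷ s ∷ xs)

data IsDiagram : List Symbol → Set where
  single : ∀ {A} → IsDiagram [ var A ]
  chain  : ∀ {A xs} → IsTail xs → IsDiagram (var A ∷ xs)

diagram : Proposition → List Symbol
diagram (𝐀 A B) = var A ∷ ⟶ ∷ var B ∷ []
diagram (𝐄 A B) = var A ∷ ⟶ ∷ ● ∷ ⟵ ∷ var B ∷ []
diagram (𝐈 A B) = var A ∷ ⟵ ∷ ● ∷ ⟶ ∷ var B ∷ []
diagram (𝐎 A B) = var A ∷ ⟵ ∷ ● ∷ ⟶ ∷ ● ∷ ⟵ ∷ var B ∷ []

------------------------------------------------------------------------
-- Rules of inference and proof trees

infix 4 _⟹_ _&_⟹_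

-- The parts 𝓓 and 𝓔 range over arbitrary lists of symbols: that the
-- expressions in a rule are diagrams is required at the nodes of a
-- proof tree, and then 𝓓 and 𝓔 are parts of those diagrams.
data _⟹_ : List Symbol → List Symbol → Set where
  A-flip   : ∀ A B → var A ∷ ⟶ ∷ var B ∷ [] ⟹ var B ∷ ⟵ ∷ var A ∷ []
  A-unflip : ∀ A B → var B ∷ ⟵ ∷ var A ∷ [] ⟹ var A ∷ ⟶ ∷ var B ∷ []
  E-flip   : ∀ A B → var A ∷ ⟶ ∷ ● ∷ ⟵ ∷ var B ∷ [] ⟹
                     var B ∷ ⟶ ∷ ● ∷ ⟵ ∷ var A ∷ []
  I-flip   : ∀ A B → var A ∷ ⟵ ∷ ● ∷ ⟶ ∷ var B ∷ [] ⟹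
                     var B ∷ ⟵ ∷ ● ∷ ⟶ ∷ var A ∷ []
  O-flip   : ∀ A B → var A ∷ ⟵ ∷ ● ∷ ⟶ ∷ ● ∷ ⟵ ∷ var B ∷ [] ⟹
                     var B ∷ ⟶ ∷ ● ∷ ⟵ ∷ ● ∷ ⟶ ∷ var A ∷ []
  O-unflip : ∀ A B → var B ∷ ⟶ ∷ ● ∷ ⟵ ∷ ● ∷ ⟶ ∷ var A ∷ [] ⟹
                     var A ∷ ⟵ ∷ ● ∷ ⟶ ∷ ● ∷ ⟵ ∷ var B ∷ []
  compose⟶ : ∀ 𝓓 A 𝓔 → 𝓓 ++ ⟶ ∷ var A ∷ ⟶ ∷ 𝓔 ⟹ 𝓓 ++ ⟶ ∷ 𝓔
  compose⟵ : ∀ 𝓓 A 𝓔 → 𝓓 ++ ⟵ ∷ var A ∷ ⟵ ∷ 𝓔 ⟹ 𝓓 ++ ⟵ ∷ 𝓔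

data _&_⟹_ : List Symbol → List Symbol → List Symbol → Set where
  join  : ∀ 𝓓 A 𝓔 → (𝓓 ∷ʳ var A) & (var A ∷ 𝓔) ⟹ 𝓓 ++ var A ∷ 𝓔
  join′ : ∀ 𝓓 A 𝓔 → (var A ∷ 𝓔) & (𝓓 ∷ʳ var A) ⟹ 𝓓 ++ var A ∷ 𝓔

-- Proof trees, indexed by their root.
data ProofTree : List Symbol → Set where
  leaf   : ∀ {x} → IsDiagram x → ProofTree x
  unary  : ∀ {x y} → IsDiagram y → x ⟹ y → ProofTree x → ProofTree y
  binary : ∀ {x y z} → IsDiagram z → x & y ⟹ z →
           ProofTree x → ProofTree y → ProofTree z

leaves : ∀ {x} → ProofTree x → List (List Symbol)
leaves (leaf {x} _)       = [ x ]
leaves (unary _ _ t)      = leaves t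
leaves (binary _ _ t₁ t₂) = leaves t₁ ++ leaves t₂

-- Every leaf is a premise and every premise is a leaf; the order and
-- the multiplicity of the leaves are not restricted.
Provable : Argument → Set
Provable (p₁ , p₂ ⊢ c) =
  Σ[ t ∈ ProofTree (diagram c) ]
    All (λ x → x ≡ diagram p₁ ⊎ x ≡ diagram p₂) (leaves t)
    × diagram p₁ ∈ leaves t
    × diagram p₂ ∈ leaves t

{-# OPTIONS --safe #-}
module Submission where

-- Unprovability is shown by models: a diagram is read from left to right as a
-- conjunction of claims about sets of individuals, every rule of inference
-- preserves these claims, and an invalid mood fails in a model with at most three
-- individuals.  As there are 256 moods and 512 such models, this is a finite
-- check.  Conversely, up to symmetry of the premises and of the conclusion, a
-- valid syllogism is one join at the middle term followed by one deletion of it.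

open import Defs
open import Data.Bool using (if_then_else_; T)
open import Data.Fin using (Fin)
open import Data.Fin.Patterns using (0F; 1F; 2F; 3F)
open import Data.Fin.Properties using (all?; any?)
open import Data.Fin.Subset using (Subset; _∈_)
open import Data.Fin.Subset.Properties using (_∈?_; _⊆?_; anySubset?)
open import Data.List using (List; []; _∷_; _++_; _∷ʳ_)
import Data.List.Membership.Propositional as List
open import Data.List.Relation.Unary.All as All using (All; []; _∷_)
open import Data.List.Relation.Unary.All.Properties using (++⁻)
open import Data.List.Relation.Unary.Any using (here; there)
open import Data.Maybe using (Maybe; just; nothing; is-just; to-witness-T)
open import Data.Nat using (_≟_)
open import Data.Product using (∃-syntax; Σ-syntax; _×_; _,_)
open import Data.Sum using (_⊎_; inj₁; inj₂; [_,_]′)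
open import Data.Unit using (tt)
open import Function using (_∘_; flip; id)
open import Function.Bundles using (_⇔_; mk⇔)
open import Level using (0ℓ)
open import Relation.Binary.PropositionalEquality using (_≡_; _≢_; refl; sym)
open import Relation.Nullary using (Dec; ¬_; does; contradiction)
open import Relation.Nullary.Decidable
  using (map′; ¬?; _×-dec_; _⊎-dec_; T?; from-yes; dec-true; dec-false)
open import Relation.Unary using (Pred; U; ∁; _⊆_; _⊥_; _≬_; ｛_｝)
open import Relation.Unary.Properties using (⊆-trans)

-- Moods as finite data: kinds and orientations.

Kind : Set
Kind = Fin 4

proposition : Kind → TermVar → TermVar → Proposition
proposition 0F = 𝐀
proposition 1F = 𝐄
proposition 2F = 𝐈
proposition 3F = 𝐎

-- Two orientations, one per premise, encode the figure: `0F 0F`, `1F 0F`, `0F 1F` and `1F 1F` are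
-- figures 1 to 4. The target type is arbitrary so that propositions and the relations `Holds k` are
-- turned in the same way.
oriented : ∀ {a b} {A : Set a} {B : Set b} → Fin 2 → (A → A → B) → A → A → B
oriented 0F f = f
oriented 1F f = flip f

-- Semantics of diagrams

Holds : {X : Set} → Kind → Pred X 0ℓ → Pred X 0ℓ → Set
Holds 0F A B = A ⊆ B
Holds 1F A B = A ⊥ B
Holds 2F A B = A ≬ B
Holds 3F A B = A ≬ ∁ B

module Semantics {X : Set} (⟦_⟧ : TermVar → Pred X 0ℓ) where

  -- Sat F G xs reads xs when what precedes it says F B if it is continued by
  -- → B, and G B if it is continued by ← B.  In A → • the bullet acts as a set
  -- which contains A and may next be said to be disjoint from B, so that ← B
  -- gives F (∁ B); in A ← • it acts as an individual, so that → B gives G ｛ x ｝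
  -- for some x in B.
  Sat : (F G : Pred (Pred X 0ℓ) 0ℓ) → List Symbol → Set
  Sat F G []           = U tt
  Sat F G (⟶ ∷ xs)     = Sat F U xs
  Sat F G (⟵ ∷ xs)     = Sat U G xs
  Sat F G (● ∷ xs)     = Sat (λ B → B ≬ (λ x → G ｛ x ｝)) (F ∘ ∁) xs
  Sat F G (var A ∷ xs) = F ⟦ A ⟧ × G ⟦ A ⟧ × Sat (⟦ A ⟧ ⊆_) (_⊆ ⟦ A ⟧) xs

  Satisfied : List Symbol → Set
  Satisfied = Sat U U

  Upward Downward : Pred (Pred X 0ℓ) 0ℓ → Set₁
  Upward   F = ∀ {A B} → F A → A ⊆ B → F B
  Downward G = ∀ {A B} → G A → B ⊆ A → G B

  -- At a bullet the two predicates change places, but both stay in positive position: the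
  -- complement acts on the argument of `F`, not on `F` itself.
  Sat-mono : ∀ {F F′ G G′} → F ⊆ F′ → G ⊆ G′ → ∀ xs → Sat F G xs → Sat F′ G′ xs
  Sat-mono f g []           _           = tt
  Sat-mono f g (⟶ ∷ xs)     s           = Sat-mono f id xs s
  Sat-mono f g (⟵ ∷ xs)     s           = Sat-mono id g xs s
  Sat-mono f g (● ∷ xs)     s           =
    Sat-mono (λ (x , x∈B , Gx) → x , x∈B , g Gx) f xs s
  Sat-mono f g (var A ∷ xs) (FA , GA , s) = f FA , g GA , s

  -- A term-variable resets the reading: what follows `var A` is judged by `⟦ A ⟧` alone, whatever
  -- came before it.
  Sat-join : ∀ {F G} 𝓓 A 𝓔 → Sat F G (𝓓 ∷ʳ var A) → Satisfied (var A ∷ 𝓔) →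
             Sat F G (𝓓 ++ var A ∷ 𝓔)
  Sat-join []          A 𝓔 (FA , GA , _) (_ , _ , s) = FA , GA , s
  Sat-join (⟶ ∷ 𝓓)     A 𝓔 s             t = Sat-join 𝓓 A 𝓔 s t
  Sat-join (⟵ ∷ 𝓓)     A 𝓔 s             t = Sat-join 𝓓 A 𝓔 s t
  Sat-join (● ∷ 𝓓)     A 𝓔 s             t = Sat-join 𝓓 A 𝓔 s t
  Sat-join (var B ∷ 𝓓) A 𝓔 (FB , GB , s) t = FB , GB , Sat-join 𝓓 A 𝓔 s t

  -- Deleting `A` is transitivity in general form: the remainder is read against `⟦ A ⟧ ⊆_`, and
  -- since `F ⟦ A ⟧` holds and `F` is upward closed, it may be read against `F` instead. For left
  -- arrows the same works with `G` downward closed.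
  Sat-compose⟶ : ∀ {F G} → Upward F → Downward G → ∀ 𝓓 A 𝓔 →
                 Sat F G (𝓓 ++ ⟶ ∷ var A ∷ ⟶ ∷ 𝓔) → Sat F G (𝓓 ++ ⟶ ∷ 𝓔)
  Sat-compose⟶ up down [] A 𝓔 (FA , _ , s) =
    Sat-mono (up FA) id 𝓔 s
  Sat-compose⟶ up down (⟶ ∷ 𝓓) A 𝓔 s = Sat-compose⟶ up _ 𝓓 A 𝓔 s
  Sat-compose⟶ up down (⟵ ∷ 𝓓) A 𝓔 s = Sat-compose⟶ _ down 𝓓 A 𝓔 s
  -- The closure conditions survive a bullet: meeting a fixed set is upward closed, and
  -- complementation turns the upward closed `F` into a downward closed predicate.
  Sat-compose⟶ up down (● ∷ 𝓓) A 𝓔 s =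
    Sat-compose⟶ (λ (x , x∈A , Gx) A⊆B → x , A⊆B x∈A , Gx)
                 (λ FA B⊆A → up FA (_∘ B⊆A)) 𝓓 A 𝓔 s
  Sat-compose⟶ up down (var B ∷ 𝓓) A 𝓔 (FB , GB , s) =
    FB , GB , Sat-compose⟶ ⊆-trans (flip ⊆-trans) 𝓓 A 𝓔 s

  Sat-compose⟵ : ∀ {F G} → Upward F → Downward G → ∀ 𝓓 A 𝓔 →
                 Sat F G (𝓓 ++ ⟵ ∷ var A ∷ ⟵ ∷ 𝓔) → Sat F G (𝓓 ++ ⟵ ∷ 𝓔)
  Sat-compose⟵ up down [] A 𝓔 (_ , GA , s) =
    Sat-mono id (down GA) 𝓔 s
  Sat-compose⟵ up down (⟶ ∷ 𝓓) A 𝓔 s = Sat-compose⟵ up _ 𝓓 A 𝓔 s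
  Sat-compose⟵ up down (⟵ ∷ 𝓓) A 𝓔 s = Sat-compose⟵ _ down 𝓓 A 𝓔 s
  Sat-compose⟵ up down (● ∷ 𝓓) A 𝓔 s =
    Sat-compose⟵ (λ (x , x∈A , Gx) A⊆B → x , A⊆B x∈A , Gx)
                 (λ FA B⊆A → up FA (_∘ B⊆A)) 𝓓 A 𝓔 s
  Sat-compose⟵ up down (var B ∷ 𝓓) A 𝓔 (FB , GB , s) =
    FB , GB , Sat-compose⟵ ⊆-trans (flip ⊆-trans) 𝓓 A 𝓔 s

  Satisfied⇒Holds : ∀ k A B →
    Satisfied (diagram (proposition k A B)) → Holds k ⟦ A ⟧ ⟦ B ⟧
  Satisfied⇒Holds 0F A B (_ , _ , A⊆B , _) = A⊆B
  Satisfied⇒Holds 1F A B (_ , _ , _ , A⊆∁B , _) (x∈A , x∈B) = A⊆∁B x∈A x∈B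
  -- `x⊆A` is the inclusion of `｛ x ｝` in `⟦ A ⟧`; `refl` applies it to `x` itself.
  Satisfied⇒Holds 2F A B (_ , _ , (x , x∈B , x⊆A) , _) = x , x⊆A refl , x∈B
  Satisfied⇒Holds 3F A B (_ , _ , _ , (x , x∉B , x⊆A) , _) = x , x⊆A refl , x∉B

  Holds⇒Satisfied : ∀ k A B →
    Holds k ⟦ A ⟧ ⟦ B ⟧ → Satisfied (diagram (proposition k A B))
  Holds⇒Satisfied 0F A B A⊆B = tt , tt , A⊆B , tt , tt
  Holds⇒Satisfied 1F A B A⊥B =
    tt , tt , tt , (λ x∈A x∈B → A⊥B (x∈A , x∈B)) , tt
  Holds⇒Satisfied 2F A B (x , x∈A , x∈B) =
    tt , tt , (x , x∈B , λ { refl → x∈A }) , tt , tt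
  Holds⇒Satisfied 3F A B (x , x∈A , x∉B) =
    tt , tt , tt , (x , x∉B , λ { refl → x∈A }) , tt

  -- Soundness of the rules and of proof trees.

  ⟹-sound : ∀ {x y} → x ⟹ y → Satisfied x → Satisfied y
  ⟹-sound (A-flip A B)   (_ , _ , A⊆B , _) = tt , tt , tt , A⊆B , tt
  ⟹-sound (A-unflip A B) (_ , _ , _ , A⊆B , _) = tt , tt , A⊆B , tt , tt
  ⟹-sound (E-flip A B)   (_ , _ , _ , A⊆∁B , _) = tt , tt , tt , (λ x∈B x∈A → A⊆∁B x∈A x∈B) , tt
  ⟹-sound (I-flip A B)   (_ , _ , (x , x∈B , x⊆A) , _) =
    tt , tt , (x , x⊆A refl , λ { refl → x∈B }) , tt , tt
  -- The reversed diagram reads: for some `x` in `A`, the set `B` avoids `｛ x ｝`.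
  ⟹-sound (O-flip A B)   (_ , _ , _ , (x , x∉B , x⊆A) , _) =
    tt , tt , (x , x⊆A refl , λ { x∈B refl → x∉B x∈B }) , tt , tt
  ⟹-sound (O-unflip A B) (_ , _ , (x , x∈A , B⊆∁x) , _) =
    tt , tt , tt , (x , (λ x∈B → B⊆∁x x∈B refl) , λ { refl → x∈A }) , tt
  ⟹-sound (compose⟶ 𝓓 A 𝓔) = Sat-compose⟶ _ _ 𝓓 A 𝓔
  ⟹-sound (compose⟵ 𝓓 A 𝓔) = Sat-compose⟵ _ _ 𝓓 A 𝓔

  &⟹-sound : ∀ {x y z} → x & y ⟹ z → Satisfied x → Satisfied y → Satisfied z
  &⟹-sound (join 𝓓 A 𝓔)  s t = Sat-join 𝓓 A 𝓔 s t
  &⟹-sound (join′ 𝓓 A 𝓔) s t = Sat-join 𝓓 A 𝓔 t s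

  ProofTree-sound : ∀ {x} (t : ProofTree x) → All Satisfied (leaves t) → Satisfied x
  ProofTree-sound (leaf _)         (s ∷ []) = s
  ProofTree-sound (unary _ r t)    ss       = ⟹-sound r (ProofTree-sound t ss)
  ProofTree-sound (binary _ r t u) ss with ++⁻ (leaves t) ss
  ... | ssₜ , ssᵤ = &⟹-sound r (ProofTree-sound t ssₜ) (ProofTree-sound u ssᵤ)

  Provable-sound : ∀ {p₁ p₂ c} → Provable (p₁ , p₂ ⊢ c) →
    Satisfied (diagram p₁) → Satisfied (diagram p₂) → Satisfied (diagram c)
  Provable-sound (t , ls , _) s₁ s₂ =
    ProofTree-sound t (All.map [ (λ { refl → s₁ }) , (λ { refl → s₂ }) ]′ ls)

  oriented-Holds⇒Satisfied : ∀ o k A B → oriented o (Holds k) ⟦ A ⟧ ⟦ B ⟧ →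
    Satisfied (diagram (oriented o (proposition k) A B))
  oriented-Holds⇒Satisfied 0F k A B = Holds⇒Satisfied k A B
  oriented-Holds⇒Satisfied 1F k A B = Holds⇒Satisfied k B A

-- Countermodels

⟨_⟩ : ∀ {n} → Subset n → Pred (Fin n) 0ℓ
⟨ s ⟩ = _∈ s

holds? : ∀ {n} k (s p : Subset n) → Dec (Holds k ⟨ s ⟩ ⟨ p ⟩)
holds? 0F s p = s ⊆? p
holds? 1F s p = map′ (λ ¬≬ (x∈s , x∈p) → ¬≬ (_ , x∈s , x∈p)) (λ s⊥p (_ , x∈) → s⊥p x∈)
                     (¬? (holds? 2F s p))
holds? 2F s p = any? (λ x → x ∈? s ×-dec x ∈? p)
holds? 3F s p = any? (λ x → x ∈? s ×-dec ¬? (x ∈? p))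

oriented-holds? : ∀ {n} o k (s p : Subset n) → Dec (oriented o (Holds k) ⟨ s ⟩ ⟨ p ⟩)
oriented-holds? 0F k s p = holds? k s p
oriented-holds? 1F k s p = holds? k p s

mood : (S P M : TermVar) → Fin 2 → Fin 2 → Kind → Kind → Kind → Argument
mood S P M o₁ o₂ k₁ k₂ k =
  oriented o₁ (proposition k₁) M P , oriented o₂ (proposition k₂) S M ⊢ proposition k S P

-- Two individuals would not suffice: 𝐎 P M , 𝐎 M S ⊢ 𝐀 S P needs three.
Countermodel : Fin 2 → Fin 2 → Kind → Kind → Kind → Set
Countermodel o₁ o₂ k₁ k₂ k =
  ∃[ m ] ∃[ p ] oriented o₁ (Holds k₁) ⟨ m ⟩ ⟨ p ⟩ ×
    Σ[ s ∈ Subset 3 ] oriented o₂ (Holds k₂) ⟨ s ⟩ ⟨ m ⟩ × ¬ Holds k ⟨ s ⟩ ⟨ p ⟩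

-- The first premise concerns only `m` and `p`, so it is decided before `s` is searched for.
countermodel? : ∀ o₁ o₂ k₁ k₂ k → Dec (Countermodel o₁ o₂ k₁ k₂ k)
countermodel? o₁ o₂ k₁ k₂ k =
  anySubset? λ m → anySubset? λ p → oriented-holds? o₁ k₁ m p ×-dec
    anySubset? λ s → oriented-holds? o₂ k₂ s m ×-dec ¬? (holds? k s p)

-- Only `just` carries evidence. That the moods sent to `nothing` are invalid is the content of
-- `valid-or-countermodel`.
mood-valid? : ∀ S P M o₁ o₂ k₁ k₂ k → Maybe (Valid S P M (mood S P M o₁ o₂ k₁ k₂ k))
mood-valid? S P M 0F 0F 0F 0F 0F = just barbara
mood-valid? S P M 0F 0F 1F 0F 1F = just celarent
mood-valid? S P M 0F 0F 0F 2F 2F = just darii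
mood-valid? S P M 0F 0F 1F 2F 3F = just ferio
mood-valid? S P M 1F 0F 1F 0F 1F = just cesare
mood-valid? S P M 1F 0F 0F 1F 1F = just camestres
mood-valid? S P M 1F 0F 1F 2F 3F = just festino
mood-valid? S P M 1F 0F 0F 3F 3F = just baroco
mood-valid? S P M 0F 1F 2F 0F 2F = just disamis
mood-valid? S P M 0F 1F 0F 2F 2F = just datisi
mood-valid? S P M 0F 1F 3F 0F 3F = just bocardo
mood-valid? S P M 0F 1F 1F 2F 3F = just ferison
mood-valid? S P M 1F 1F 0F 1F 1F = just calemes
mood-valid? S P M 1F 1F 2F 0F 2F = just dimatis
mood-valid? S P M 1F 1F 1F 2F 3F = just fresison
mood-valid? S P M _  _  _  _  _  = nothing

-- This is the finite check. Both alternatives are decided by the five finite indices alone, so the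
-- decision evaluates with `S`, `P` and `M` left as variables.
valid-or-countermodel : ∀ S P M o₁ o₂ k₁ k₂ k →
  T (is-just (mood-valid? S P M o₁ o₂ k₁ k₂ k)) ⊎ Countermodel o₁ o₂ k₁ k₂ k
valid-or-countermodel S P M = from-yes
  (all? λ o₁ → all? λ o₂ → all? λ k₁ → all? λ k₂ → all? λ k →
    T? (is-just (mood-valid? S P M o₁ o₂ k₁ k₂ k)) ⊎-dec countermodel? o₁ o₂ k₁ k₂ k)

module _ {S P M : TermVar} (S≢P : S ≢ P) (S≢M : S ≢ M) (P≢M : P ≢ M)
         {A : Set} (s p m : A) where

  -- Every variable other than `S` and `P` gets the default `m`. Distinctness of the three terms
  -- ensures that each receives its own set, so a countermodel extends to a valuation of all
  -- variables.
  assign : TermVar → A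
  assign v = if does (v ≟ S) then s else if does (v ≟ P) then p else m

  assign-S : assign S ≡ s
  assign-S rewrite dec-true (S ≟ S) refl = refl

  assign-P : assign P ≡ p
  assign-P rewrite dec-false (P ≟ S) (S≢P ∘ sym) | dec-true (P ≟ P) refl = refl

  assign-M : assign M ≡ m
  assign-M rewrite dec-false (M ≟ S) (S≢M ∘ sym) | dec-false (M ≟ P) (P≢M ∘ sym) = refl

Countermodel⇒¬Provable : ∀ {S P M} → S ≢ P → S ≢ M → P ≢ M → ∀ o₁ o₂ k₁ k₂ k →
  Countermodel o₁ o₂ k₁ k₂ k → ¬ Provable (mood S P M o₁ o₂ k₁ k₂ k)
Countermodel⇒¬Provable {S} {P} {M} S≢P S≢M P≢M o₁ o₂ k₁ k₂ k (m , p , h₁ , s , h₂ , ¬h) π =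
  ¬h-assign (Satisfied⇒Holds k S P
    (Provable-sound π
      (oriented-Holds⇒Satisfied o₁ k₁ M P h₁-assign)
      (oriented-Holds⇒Satisfied o₂ k₂ S M h₂-assign)))
  where
  α : TermVar → Subset 3
  α = assign S≢P S≢M P≢M s p m

  open Semantics (λ v → ⟨ α v ⟩)

  h₁-assign : oriented o₁ (Holds k₁) ⟨ α M ⟩ ⟨ α P ⟩
  h₁-assign rewrite assign-M S≢P S≢M P≢M s p m | assign-P S≢P S≢M P≢M s p m = h₁

  h₂-assign : oriented o₂ (Holds k₂) ⟨ α S ⟩ ⟨ α M ⟩
  h₂-assign rewrite assign-S S≢P S≢M P≢M s p m | assign-M S≢P S≢M P≢M s p m = h₂

  ¬h-assign : ¬ Holds k ⟨ α S ⟩ ⟨ α P ⟩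
  ¬h-assign rewrite assign-S S≢P S≢M P≢M s p m | assign-P S≢P S≢M P≢M s p m = ¬h

Provable⇒Valid-mood : ∀ {S P M} → S ≢ P → S ≢ M → P ≢ M → ∀ o₁ o₂ k₁ k₂ k →
  Provable (mood S P M o₁ o₂ k₁ k₂ k) → Valid S P M (mood S P M o₁ o₂ k₁ k₂ k)
Provable⇒Valid-mood {S} {P} {M} S≢P S≢M P≢M o₁ o₂ k₁ k₂ k π =
  [ to-witness-T (mood-valid? S P M o₁ o₂ k₁ k₂ k)
  , contradiction π ∘ Countermodel⇒¬Provable S≢P S≢M P≢M o₁ o₂ k₁ k₂ k
  ]′ (valid-or-countermodel S P M o₁ o₂ k₁ k₂ k)

-- From syllogisms to moods.

kind : ∀ p → ∃[ k ] p ≡ proposition k (subject p) (predicate p)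
kind (𝐀 A B) = 0F , refl
kind (𝐄 A B) = 1F , refl
kind (𝐈 A B) = 2F , refl
kind (𝐎 A B) = 3F , refl

Involves⇒oriented : ∀ {A B} p → Involves A B p →
                    ∃[ o ] ∃[ k ] p ≡ oriented o (proposition k) A B
Involves⇒oriented p (inj₁ (refl , refl)) = 0F , kind p
Involves⇒oriented p (inj₂ (refl , refl)) = 1F , kind p

IsSyllogism⇒mood : ∀ {S P M σ} → IsSyllogism S P M σ →
  ∃[ o₁ ] ∃[ o₂ ] ∃[ k₁ ] ∃[ k₂ ] ∃[ k ] σ ≡ mood S P M o₁ o₂ k₁ k₂ k
IsSyllogism⇒mood {σ = p₁ , p₂ ⊢ c} record
  { premise₁-terms = t₁ ; premise₂-terms = t₂
  ; conclusion-subject = refl ; conclusion-predicate = refl }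
  with Involves⇒oriented p₁ t₁ | Involves⇒oriented p₂ t₂ | kind c
... | o₁ , k₁ , eq₁ | o₂ , k₂ , eq₂ | k , eq =
  o₁ , o₂ , k₁ , k₂ , k , cong₃ _,_⊢_ eq₁ eq₂ eq
  where
  cong₃ : ∀ {A B C D : Set} (f : A → B → C → D) {a a′ b b′ c c′} →
          a ≡ a′ → b ≡ b′ → c ≡ c′ → f a b c ≡ f a′ b′ c′
  cong₃ f refl refl refl = refl

Provable⇒Valid : ∀ {S P M} → S ≢ P → S ≢ M → P ≢ M → ∀ {σ} → IsSyllogism S P M σ →
                 Provable σ → Valid S P M σ
Provable⇒Valid S≢P S≢M P≢M syl π with IsSyllogism⇒mood syl
... | o₁ , o₂ , k₁ , k₂ , k , refl = Provable⇒Valid-mood S≢P S≢M P≢M o₁ o₂ k₁ k₂ k π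

-- Proof trees of the valid syllogisms

diagram-isDiagram : ∀ p → IsDiagram (diagram p)
diagram-isDiagram (𝐀 A B) = chain (end right)
diagram-isDiagram (𝐄 A B) = chain (step right bullet (end left))
diagram-isDiagram (𝐈 A B) = chain (step left bullet (end right))
diagram-isDiagram (𝐎 A B) = chain (step left bullet (step right bullet (end left)))

module _ {A B : TermVar} where

  E-converse : ProofTree (diagram (𝐄 A B)) → ProofTree (diagram (𝐄 B A))
  E-converse = unary (diagram-isDiagram (𝐄 B A)) (E-flip A B)

  I-converse : ProofTree (diagram (𝐈 A B)) → ProofTree (diagram (𝐈 B A))
  I-converse = unary (diagram-isDiagram (𝐈 B A)) (I-flip A B)

  A-reverse : ProofTree (diagram (𝐀 A B)) → ProofTree (var B ∷ ⟵ ∷ var A ∷ [])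
  A-reverse = unary (chain (end left)) (A-flip A B)

module _ {S M P : TermVar} where

  -- `join′` takes the premise starting at `M` as its first subtree, which keeps the leaves in the
  -- order of the premises; the deletion then removes `M`. The trees below follow this pattern.
  barbara-tree : ProofTree (diagram (𝐀 M P)) → ProofTree (diagram (𝐀 S M)) →
                 ProofTree (diagram (𝐀 S P))
  barbara-tree t u =
    unary (diagram-isDiagram (𝐀 S P)) (compose⟶ (var S ∷ []) M (var P ∷ []))
      (binary (chain (step right term (end right)))
              (join′ (var S ∷ ⟶ ∷ []) M (⟶ ∷ var P ∷ [])) t u)

  celarent-tree : ProofTree (diagram (𝐄 M P)) → ProofTree (diagram (𝐀 S M)) →
                  ProofTree (diagram (𝐄 S P))
  celarent-tree t u =
    unary (diagram-isDiagram (𝐄 S P)) (compose⟶ (var S ∷ []) M (● ∷ ⟵ ∷ var P ∷ []))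
      (binary (chain (step right term (step right bullet (end left))))
              (join′ (var S ∷ ⟶ ∷ []) M (⟶ ∷ ● ∷ ⟵ ∷ var P ∷ [])) t u)

  darii-tree : ProofTree (diagram (𝐀 M P)) → ProofTree (diagram (𝐈 S M)) →
               ProofTree (diagram (𝐈 S P))
  darii-tree t u =
    unary (diagram-isDiagram (𝐈 S P)) (compose⟶ (var S ∷ ⟵ ∷ ● ∷ []) M (var P ∷ []))
      (binary (chain (step left bullet (step right term (end right))))
              (join′ (var S ∷ ⟵ ∷ ● ∷ ⟶ ∷ []) M (⟶ ∷ var P ∷ [])) t u)

  ferio-tree : ProofTree (diagram (𝐄 M P)) → ProofTree (diagram (𝐈 S M)) →
               ProofTree (diagram (𝐎 S P))
  ferio-tree t u =
    unary (diagram-isDiagram (𝐎 S P))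
          (compose⟶ (var S ∷ ⟵ ∷ ● ∷ []) M (● ∷ ⟵ ∷ var P ∷ []))
      (binary (chain (step left bullet (step right term (step right bullet (end left)))))
              (join′ (var S ∷ ⟵ ∷ ● ∷ ⟶ ∷ []) M (⟶ ∷ ● ∷ ⟵ ∷ var P ∷ [])) t u)

  -- Converting an 𝐎 diagram does not give another 𝐎 diagram, so here and in `bocardo-tree` the 𝐀
  -- premise is reversed instead, making both arrows at `M` point left.
  baroco-tree : ProofTree (diagram (𝐀 P M)) → ProofTree (diagram (𝐎 S M)) →
                ProofTree (diagram (𝐎 S P))
  baroco-tree t u =
    unary (diagram-isDiagram (𝐎 S P))
          (compose⟵ (var S ∷ ⟵ ∷ ● ∷ ⟶ ∷ ● ∷ []) M (var P ∷ []))
      (binary (chain (step left bullet (step right bullet (step left term (end left)))))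
              (join′ (var S ∷ ⟵ ∷ ● ∷ ⟶ ∷ ● ∷ ⟵ ∷ []) M (⟵ ∷ var P ∷ []))
              (A-reverse t) u)

  bocardo-tree : ProofTree (diagram (𝐎 M P)) → ProofTree (diagram (𝐀 M S)) →
                 ProofTree (diagram (𝐎 S P))
  bocardo-tree t u =
    unary (diagram-isDiagram (𝐎 S P))
          (compose⟵ (var S ∷ []) M (● ∷ ⟶ ∷ ● ∷ ⟵ ∷ var P ∷ []))
      (binary (chain (step left term (step left bullet (step right bullet (end left)))))
              (join′ (var S ∷ ⟵ ∷ []) M (⟵ ∷ ● ∷ ⟶ ∷ ● ∷ ⟵ ∷ var P ∷ []))
              t (A-reverse u))

-- A stronger property than provability: each premise is used as a leaf exactly once. Both orders
-- are allowed because some moods are obtained with the premises exchanged.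
DerivableOnce : Argument → Set
DerivableOnce (p₁ , p₂ ⊢ c) = Σ[ t ∈ ProofTree (diagram c) ]
  (leaves t ≡ diagram p₁ ∷ diagram p₂ ∷ [] ⊎ leaves t ≡ diagram p₂ ∷ diagram p₁ ∷ [])

DerivableOnce⇒Provable : ∀ {σ} → DerivableOnce σ → Provable σ
DerivableOnce⇒Provable {p₁ , p₂ ⊢ c} (t , eq) = t , spread eq
  where
  spread : ∀ {xs} →
    xs ≡ diagram p₁ ∷ diagram p₂ ∷ [] ⊎ xs ≡ diagram p₂ ∷ diagram p₁ ∷ [] →
    All (λ x → x ≡ diagram p₁ ⊎ x ≡ diagram p₂) xs
      × diagram p₁ List.∈ xs × diagram p₂ List.∈ xs
  spread (inj₁ refl) = inj₁ refl ∷ inj₂ refl ∷ [] , here refl , there (here refl)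
  spread (inj₂ refl) = inj₂ refl ∷ inj₁ refl ∷ [] , there (here refl) , here refl

Valid⇒DerivableOnce : ∀ {S P M σ} → Valid S P M σ → DerivableOnce σ
Valid⇒DerivableOnce {S} {P} {M} = λ where
    barbara   → barbara-tree (h (𝐀 M P)) (h (𝐀 S M)) , inj₁ refl
    celarent  → celarent-tree (h (𝐄 M P)) (h (𝐀 S M)) , inj₁ refl
    darii     → darii-tree (h (𝐀 M P)) (h (𝐈 S M)) , inj₁ refl
    ferio     → ferio-tree (h (𝐄 M P)) (h (𝐈 S M)) , inj₁ refl
    cesare    → celarent-tree (E-converse (h (𝐄 P M))) (h (𝐀 S M)) , inj₁ refl
    -- Here and in disamis, calemes and dimatis, `S` and `P` trade roles, and with them the two
    -- premises; converting the symmetric conclusion restores the order of its terms.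
    camestres → E-converse (celarent-tree (E-converse (h (𝐄 S M))) (h (𝐀 P M))) , inj₂ refl
    festino   → ferio-tree (E-converse (h (𝐄 P M))) (h (𝐈 S M)) , inj₁ refl
    baroco    → baroco-tree (h (𝐀 P M)) (h (𝐎 S M)) , inj₁ refl
    disamis   → I-converse (darii-tree (h (𝐀 M S)) (I-converse (h (𝐈 M P)))) , inj₂ refl
    datisi    → darii-tree (h (𝐀 M P)) (I-converse (h (𝐈 M S))) , inj₁ refl
    bocardo   → bocardo-tree (h (𝐎 M P)) (h (𝐀 M S)) , inj₁ refl
    ferison   → ferio-tree (h (𝐄 M P)) (I-converse (h (𝐈 M S))) , inj₁ refl
    calemes   → E-converse (celarent-tree (h (𝐄 M S)) (h (𝐀 P M))) , inj₂ refl
    dimatis   → I-converse (darii-tree (h (𝐀 M S)) (h (𝐈 P M))) , inj₂ refl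
    fresison  → ferio-tree (E-converse (h (𝐄 P M))) (I-converse (h (𝐈 M S))) , inj₁ refl
  where
  h : ∀ p → ProofTree (diagram p)
  h p = leaf (diagram-isDiagram p)

theorem3p15 : ∀ (S P M : TermVar) → S ≢ P → S ≢ M → P ≢ M →
    ∀ (σ : Argument) → IsSyllogism S P M σ →
    Valid S P M σ ⇔ Provable σ
theorem3p15 S P M S≢P S≢M P≢M σ syl =
  mk⇔ (DerivableOnce⇒Provable ∘ Valid⇒DerivableOnce) (Provable⇒Valid S≢P S≢M P≢M syl)
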